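{- For $n\geq1$ and $0\leq k\leq n-1$, $$\bigl|\{e\in\mathbf{I}_n(\geq,-,>): e_n=k\}\bigr|=\bigl|\{e\in\mathbf{I}_n(021): e_n\equiv k+1 \pmod n\}\bigr|.$$ (Since $0\leq e_n\leq n-1$, the right-hand condition means $e_n=k+1$ if $k\leq n-2$ and $e_n=0$ if $k=n-1$.)
   Context: $\mathbf{I}_n=\{(e_1,\ldots,e_n): 0\leq e_i<i\}$ is the set of inversion sequences of length $n$. $\mathbf{I}_n(\geq,-,>)$ is the set of $e\in\mathbf{I}_n$ with no indices $i<j<k$ such that $e_i\geq e_j$ and $e_i>e_k$. $\mathbf{I}_n(021)$ is the set of $e\in\mathbf{I}_n$ with no indices $i<j<k$ such that $e_i<e_k<e_j$ (equivalently, the positive entries of $e$ are weakly increasing). -}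

module Defs where

open import Data.Nat using (ℕ; zero; suc; _<ᵇ_; _≡ᵇ_)
open import Data.Nat.DivMod using (_%_)
open import Data.Bool using (Bool; true; false; _∧_; _∨_; not; T)
open import Data.List using (List; []; _∷_; length; all)
open import Data.Product using (Σ; _×_)

-- An inversion sequence e = (e_1,...,e_n) is represented as the list
-- [e_1, ..., e_n] of naturals; IsInvSeq n e says length e = n and
-- e_i < i for each (1-based) position i.
-- isInvFrom i e : every entry at 1-based position i, i+1, ... is below its position
isInvFrom : ℕ → List ℕ → Bool
isInvFrom i [] = true
isInvFrom i (x ∷ xs) = (x <ᵇ i) ∧ isInvFrom (suc i) xs

IsInvSeq : ℕ → List ℕ → Bool
IsInvSeq n e = (length e ≡ᵇ n) ∧ isInvFrom 1 e

anyL : (ℕ → Bool) → List ℕ → Bool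
anyL p [] = false
anyL p (x ∷ xs) = p x ∨ anyL p xs

hasPatFrom≥> : ℕ → List ℕ → Bool
hasPatFrom≥> a [] = false
hasPatFrom≥> a (y ∷ ys) =
  ((y <ᵇ suc a) ∧ anyL (λ z → z <ᵇ a) ys) ∨ hasPatFrom≥> a ys

contains≥> : List ℕ → Bool
contains≥> [] = false
contains≥> (x ∷ xs) = hasPatFrom≥> x xs ∨ contains≥> xs

hasPatFrom021 : ℕ → List ℕ → Bool
hasPatFrom021 a [] = false
hasPatFrom021 a (y ∷ ys) =
  anyL (λ z → (a <ᵇ z) ∧ (z <ᵇ y)) ys ∨ hasPatFrom021 a ys

contains021 : List ℕ → Bool
contains021 [] = false
contains021 (x ∷ xs) = hasPatFrom021 x xs ∨ contains021 xs

-- last entry (default 0 on empty list; only used for n ≥ 1)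
lastE : List ℕ → ℕ
lastE [] = 0
lastE (x ∷ []) = x
lastE (x ∷ y ∷ ys) = lastE (y ∷ ys)

LeftSet : ℕ → ℕ → Set
LeftSet n k = Σ (List ℕ) λ e →
  T (IsInvSeq n e ∧ not (contains≥> e) ∧ (lastE e ≡ᵇ k))

RightSet : ℕ → ℕ → Set
RightSet n k = Σ (List ℕ) λ e →
  T (IsInvSeq n e ∧ not (contains021 e) ∧ ((lastE e % suc (n Data.Nat.∸ 1)) ≡ᵇ (suc k % suc (n Data.Nat.∸ 1))))

{-# OPTIONS --safe #-}
module Submission where

-- Both classes are read by automata: a (≥,-,>)-avoider carries its maximum M and the threshold t, the
-- largest e_i with some later e_j ≤ e_i; the next entry z must satisfy z ≥ t, and leads to (M, M) if
-- z ≤ M and to (z, t) otherwise.  A 021-avoider carries its maximum m; the next entry is 0 or ≥ m.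
-- Hence the two sides of the theorem for length n + 1 count the avoiders of length n with t ≤ k and
-- with m ≤ k + 1, and for k < n the latter numbers b satisfy b(n+1,k) = b(n,k) + Σ_{j≤k} b(n,j).
-- The former satisfy the same recurrence because, for t < B ≤ n, there are as many avoiders of
-- length n + 1 with threshold exactly t and all entries below B as avoiders of length n with
-- threshold at most t and all entries below B; this is proved by induction on n and B.

open import Defs
open import Data.Nat using (ℕ; suc; _<_; _≤_)
open import Function.Bundles using (_⤖_)

open import Algebra.Properties.CommutativeSemigroup using (interchange)
open import Data.Bool using (Bool; true; false; T; not; _∧_; _∨_; if_then_else_)
open import Data.Bool.Properties using (T-irrelevant)
open import Data.Empty using (⊥-elim)
open import Data.Fin using (Fin)
open import Data.Fin.Properties using (+↔⊎; 0↔⊥; 1↔⊤)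
open import Data.List using (List; []; _∷_; length)
open import Data.Maybe using (Maybe; just; nothing; maybe′)
open import Data.Maybe.Relation.Unary.All using (All; just; nothing)
open import Data.Nat using (zero; pred; _+_; _*_; _<ᵇ_; _≡ᵇ_; z≤n; s≤s; s≤s⁻¹; _≟_; _≤?_; _<?_)
open import Data.Nat.DivMod using (_%_; m<n⇒m%n≡m; n%n≡0)
open import Data.Nat.Properties
open import Data.Product using (Σ; _×_; _,_; proj₁; proj₂)
open import Data.Sum using (_⊎_; inj₁; inj₂)
open import Data.Sum.Function.Propositional using (_⊎-↔_)
open import Data.Unit using (tt)
open import Function.Base using (_∘_)
open import Function.Bundles using (_↔_; mk↔ₛ′)
open import Function.Construct.Composition using (_↔-∘_)
open import Function.Construct.Symmetry using (↔-sym)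
open import Function.Properties.Inverse using (↔⇒⤖)
open import Relation.Binary.Definitions using (tri<; tri≈; tri>)
open import Relation.Binary.PropositionalEquality using (_≡_; refl; sym; trans; cong; cong₂; subst; module ≡-Reasoning)
open import Relation.Nullary using (Dec; yes; no; does; ¬_)
open import Relation.Nullary.Decidable using (dec-true; dec-false)

open ≡-Reasoning

-- Indicators and finite sums

ind : Bool → ℕ
ind true  = 1
ind false = 0

⟦_⟧ : {P : Set} → Dec P → ℕ
⟦ P? ⟧ = ind (does P?)

⟦⟧-yes : {P : Set} (P? : Dec P) → P → ⟦ P? ⟧ ≡ 1
⟦⟧-yes P? p = cong ind (dec-true P? p)

⟦⟧-no : {P : Set} (P? : Dec P) → ¬ P → ⟦ P? ⟧ ≡ 0
⟦⟧-no P? ¬p = cong ind (dec-false P? ¬p)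

⟦⟧-cong : {P Q : Set} (P? : Dec P) (Q? : Dec Q) → (P → Q) → (Q → P) → ⟦ P? ⟧ ≡ ⟦ Q? ⟧
⟦⟧-cong (yes p) Q? f g = sym (⟦⟧-yes Q? (f p))
⟦⟧-cong (no ¬p) Q? f g = sym (⟦⟧-no Q? (¬p ∘ g))

⟦<suc⟧ : ∀ a b → ⟦ a <? suc b ⟧ ≡ ⟦ a <? b ⟧ + ⟦ a ≟ b ⟧
⟦<suc⟧ a b with <-cmp a b
... | tri< a<b a≢b _
  rewrite ⟦⟧-yes (a <? suc b) (m≤n⇒m≤1+n a<b) | ⟦⟧-yes (a <? b) a<b | ⟦⟧-no (a ≟ b) a≢b = refl
... | tri≈ a≮b refl _
  rewrite ⟦⟧-yes (a <? suc a) ≤-refl | ⟦⟧-no (a <? a) a≮b | ⟦⟧-yes (a ≟ a) refl = refl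
... | tri> a≮b a≢b b<a
  rewrite ⟦⟧-no (a <? suc b) (<⇒≱ b<a ∘ s≤s⁻¹) | ⟦⟧-no (a <? b) a≮b | ⟦⟧-no (a ≟ b) a≢b = refl

∑ : ℕ → (ℕ → ℕ) → ℕ
∑ zero    f = 0
∑ (suc n) f = f 0 + ∑ n (f ∘ suc)

∑-cong : ∀ n {f g : ℕ → ℕ} → (∀ z → z < n → f z ≡ g z) → ∑ n f ≡ ∑ n g
∑-cong zero    eq = refl
∑-cong (suc n) eq = cong₂ _+_ (eq 0 (s≤s z≤n)) (∑-cong n λ z z<n → eq (suc z) (s≤s z<n))

∑-zero : ∀ n → ∑ n (λ _ → 0) ≡ 0
∑-zero zero    = refl
∑-zero (suc n) = ∑-zero n

∑-+ : ∀ n f g → ∑ n (λ z → f z + g z) ≡ ∑ n f + ∑ n g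
∑-+ zero    f g = refl
∑-+ (suc n) f g = trans (cong (f 0 + g 0 +_) (∑-+ n _ _))
  (interchange +-commutativeSemigroup (f 0) (g 0) _ _)

∑-*ˡ : ∀ c n f → ∑ n (λ z → c * f z) ≡ c * ∑ n f
∑-*ˡ c zero    f = sym (*-zeroʳ c)
∑-*ˡ c (suc n) f = trans (cong (c * f 0 +_) (∑-*ˡ c n _)) (sym (*-distribˡ-+ c (f 0) _))

∑-last : ∀ n f → ∑ (suc n) f ≡ ∑ n f + f n
∑-last zero    f = +-comm (f 0) 0
∑-last (suc n) f = trans (cong (f 0 +_) (∑-last n (f ∘ suc))) (sym (+-assoc (f 0) _ _))

∑-pick : ∀ {k n} (f : ℕ → ℕ) → k < n → ∑ n (λ z → ⟦ z ≟ k ⟧ * f z) ≡ f k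
∑-pick {zero}  {suc n} f _         = trans (cong₂ _+_ (+-identityʳ (f 0)) (∑-zero n)) (+-identityʳ (f 0))
∑-pick {suc k} {suc n} f (s≤s k<n) = ∑-pick (f ∘ suc) k<n

∑-truncate : ∀ {m n} (f : ℕ → ℕ) → m ≤ n → ∑ n (λ z → f z * ⟦ z <? m ⟧) ≡ ∑ m f
∑-truncate {n = n} f z≤n = trans (∑-cong n λ z _ → *-zeroʳ (f z)) (∑-zero n)
∑-truncate f (s≤s m≤n)   = cong₂ _+_ (*-identityʳ (f 0)) (∑-truncate (f ∘ suc) m≤n)

∑-⟦≟⟧ : ∀ n a → ∑ n (λ s → ⟦ a ≟ s ⟧) ≡ ⟦ a <? n ⟧
∑-⟦≟⟧ zero    a = refl
∑-⟦≟⟧ (suc n) a = trans (∑-last n _) (trans (cong (_+ ⟦ a ≟ n ⟧) (∑-⟦≟⟧ n a)) (sym (⟦<suc⟧ a n)))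

-- Counting words of bounded letters

∑words : ℕ → ℕ → (List ℕ → ℕ) → ℕ
∑words zero    i w = w []
∑words (suc n) i w = ∑ i λ z → ∑words n (suc i) λ xs → w (z ∷ xs)

∑words-cong : ∀ n i {v w : List ℕ → ℕ} → (∀ xs → v xs ≡ w xs) → ∑words n i v ≡ ∑words n i w
∑words-cong zero    i eq = eq []
∑words-cong (suc n) i eq = ∑-cong i λ z _ → ∑words-cong n (suc i) λ xs → eq (z ∷ xs)

∑words-zero : ∀ n i → ∑words n i (λ _ → 0) ≡ 0
∑words-zero zero    i = refl
∑words-zero (suc n) i = trans (∑-cong i λ _ _ → ∑words-zero n (suc i)) (∑-zero i)

-- At `i = 1` and length `suc n` both `LeftSet` and `RightSet` unfold to this shape, so `Words↔Fin`
-- counts them directly.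
Words : ℕ → ℕ → (List ℕ → Bool) → Set
Words n i p = Σ (List ℕ) λ e → T (((length e ≡ᵇ n) ∧ isInvFrom i e) ∧ p e)

Σ-T-≡ : {A : Set} {p : A → Bool} {x y : Σ A (T ∘ p)} → proj₁ x ≡ proj₁ y → x ≡ y
Σ-T-≡ {x = a , _} refl = cong (a ,_) (T-irrelevant _ _)

T↔Fin : ∀ b → T b ↔ Fin (ind b)
T↔Fin true  = ↔-sym 1↔⊤
T↔Fin false = ↔-sym 0↔⊥

Σ<↔Fin∑ : ∀ i {A : ℕ → Set} {f : ℕ → ℕ} → (∀ z → A z ↔ Fin (f z)) →
          Σ ℕ (λ z → T (z <ᵇ i) × A z) ↔ Fin (∑ i f)
Σ<↔Fin∑ zero    A↔ = ↔-sym 0↔⊥ ↔-∘ mk↔ₛ′ (λ ()) (λ ()) (λ ()) (λ ())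
Σ<↔Fin∑ (suc i) {A} A↔ = ↔-sym +↔⊎ ↔-∘ ((A↔ 0 ⊎-↔ Σ<↔Fin∑ i (A↔ ∘ suc)) ↔-∘ split)
  where
  split : Σ ℕ (λ z → T (z <ᵇ suc i) × A z) ↔ (A 0 ⊎ Σ ℕ (λ z → T (z <ᵇ i) × A (suc z)))
  split = mk↔ₛ′
    (λ { (zero , _ , a) → inj₁ a ; (suc z , z<i , a) → inj₂ (z , z<i , a) })
    (λ { (inj₁ a) → zero , tt , a ; (inj₂ (z , z<i , a)) → suc z , z<i , a })
    (λ { (inj₁ a) → refl ; (inj₂ _) → refl })
    (λ { (zero , _ , a) → refl ; (suc z , _ , a) → refl })

T-∧-shuffle : ∀ {a b c d} → T ((a ∧ (b ∧ c)) ∧ d) → T b × T ((a ∧ c) ∧ d)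
T-∧-shuffle {true} {true} h = tt , h

T-∧-unshuffle : ∀ {a b c d} → T b → T ((a ∧ c) ∧ d) → T ((a ∧ (b ∧ c)) ∧ d)
T-∧-unshuffle {true} {true} _ h = h

Words↔Fin : ∀ n i p → Words n i p ↔ Fin (∑words n i (ind ∘ p))
Words↔Fin zero i p = T↔Fin (p []) ↔-∘ mk↔ₛ′
  (λ { ([] , h) → h })
  (λ h → [] , h)
  (λ _ → refl)
  (λ { ([] , h) → refl })
Words↔Fin (suc n) i p = Σ<↔Fin∑ i (λ z → Words↔Fin n (suc i) (p ∘ (z ∷_))) ↔-∘ mk↔ₛ′
  (λ { (z ∷ xs , h) → let z<i , h′ = T-∧-shuffle {length xs ≡ᵇ n} {z <ᵇ i} h in z , z<i , xs , h′ ; ([] , ()) })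
  (λ { (z , z<i , xs , h) → z ∷ xs , T-∧-unshuffle {length xs ≡ᵇ n} {z <ᵇ i} z<i h })
  (λ { (z , z<i , xs , h) → cong (z ,_) (cong₂ _,_ (T-irrelevant _ _) (Σ-T-≡ refl)) })
  (λ { (z ∷ xs , h) → Σ-T-≡ refl ; ([] , ()) })

-- Words accepted by a deterministic automaton

module Automaton {Q : Set} (δ : Q → ℕ → Maybe Q) where

  run : Q → List ℕ → Bool
  run q []       = true
  run q (z ∷ xs) = maybe′ (λ q′ → run q′ xs) false (δ q z)

  weight : (Q → ℕ) → Q → List ℕ → ℕ
  weight f q []       = f q
  weight f q (z ∷ xs) = maybe′ (λ q′ → weight f q′ xs) 0 (δ q z)

  push : ℕ → (Q → ℕ) → Q → ℕ
  push b f q = ∑ b λ z → maybe′ f 0 (δ q z)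

  enabled : (ℕ → Bool) → ℕ → Q → ℕ
  enabled φ b q = ∑ b λ z → ind (φ z) * maybe′ (λ _ → 1) 0 (δ q z)

  -- The last letter ranges below `n + i`; summing it out first replaces the weight of the final
  -- state by its `push`.
  ∑words-weight-suc : ∀ n i f q → ∑words (suc n) i (weight f q) ≡ ∑words n i (weight (push (n + i) f) q)
  ∑words-weight-suc zero    i f q = refl
  ∑words-weight-suc (suc n) i f q = ∑-cong i λ z _ → lemma (δ q z)
    where
    lemma : ∀ mq → ∑words (suc n) (suc i) (λ xs → maybe′ (λ q′ → weight f q′ xs) 0 mq) ≡
                   ∑words n (suc i) (λ xs → maybe′ (λ q′ → weight (push (suc n + i) f) q′ xs) 0 mq)
    lemma (just q′) = trans (∑words-weight-suc n (suc i) f q′)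
                        (cong (λ b → ∑words n (suc i) (weight (push b f) q′)) (+-suc n i))
    lemma nothing   = trans (∑words-zero (suc n) (suc i)) (sym (∑words-zero n (suc i)))

  -- Every state is accepting, so after the first `n` letters the last one only has to satisfy `φ`
  -- and have a transition.
  ∑words-last : ∀ φ n i q →
    ∑words (suc n) i (λ e → ind (run q e ∧ φ (lastE e))) ≡ ∑words n i (weight (enabled φ (n + i)) q)
  ∑words-last φ zero i q = ∑-cong i λ z _ → lemma (δ q z) (φ z)
    where
    lemma : ∀ mq b → ind (maybe′ (λ _ → true) false mq ∧ b) ≡ ind b * maybe′ (λ _ → 1) 0 mq
    lemma (just _) true  = refl
    lemma (just _) false = refl
    lemma nothing  b     = sym (*-zeroʳ (ind b))
  ∑words-last φ (suc n) i q = ∑-cong i λ z _ → lemma (δ q z)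
    where
    lemma : ∀ mq → ∑ (suc i) (λ y → ∑words n (suc (suc i)) λ ys →
                     ind (maybe′ (λ q′ → run q′ (y ∷ ys)) false mq ∧ φ (lastE (y ∷ ys)))) ≡
                   ∑words n (suc i) (λ xs → maybe′ (λ q′ → weight (enabled φ (suc n + i)) q′ xs) 0 mq)
    lemma (just q′) = trans (∑words-last φ n (suc i) q′)
                        (cong (λ b → ∑words n (suc i) (weight (enabled φ b) q′)) (+-suc n i))
    lemma nothing   = trans (∑words-zero (suc n) (suc i)) (sym (∑words-zero n (suc i)))

  module Total (q₀ : Q) where

    -- The sum of f over the states reached by the accepted words of length n.
    total : ℕ → (Q → ℕ) → ℕ
    total zero    f = f q₀
    total (suc n) f = total n (push (suc n) f)

    ∑words-weight : ∀ n f → ∑words n 1 (weight f q₀) ≡ total n f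
    ∑words-weight zero    f = refl
    ∑words-weight (suc n) f = begin
      ∑words (suc n) 1 (weight f q₀)             ≡⟨ ∑words-weight-suc n 1 f q₀ ⟩
      ∑words n 1 (weight (push (n + 1) f) q₀)    ≡⟨ ∑words-weight n _ ⟩
      total n (push (n + 1) f)                   ≡⟨ cong (λ b → total n (push b f)) (+-comm n 1) ⟩
      total n (push (suc n) f)                   ∎

    count-last : ∀ φ n → ∑words (suc n) 1 (λ e → ind (run q₀ e ∧ φ (lastE e))) ≡ total n (enabled φ (suc n))
    count-last φ n = begin
      ∑words (suc n) 1 (λ e → ind (run q₀ e ∧ φ (lastE e)))  ≡⟨ ∑words-last φ n 1 q₀ ⟩
      ∑words n 1 (weight (enabled φ (n + 1)) q₀)             ≡⟨ ∑words-weight n _ ⟩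
      total n (enabled φ (n + 1))                            ≡⟨ cong (λ b → total n (enabled φ b)) (+-comm n 1) ⟩
      total n (enabled φ (suc n))                            ∎

    -- `Inv n` holds of every state reached after `n` letters, so identities between weights need
    -- checking on such states only.
    module Invariant (Inv : ℕ → Q → Set) (inv₀ : Inv 0 q₀)
      (inv-step : ∀ {n q z} → Inv n q → z ≤ n → All (Inv (suc n)) (δ q z)) where

      total-cong : ∀ n {f g} → (∀ q → Inv n q → f q ≡ g q) → total n f ≡ total n g
      total-cong zero    eq = eq q₀ inv₀
      total-cong (suc n) {f} {g} eq = total-cong n λ q inv → ∑-cong (suc n) λ z z<1+n →
        lemma (inv-step inv (s≤s⁻¹ z<1+n))
        where
        lemma : ∀ {mq} → All (Inv (suc n)) mq → maybe′ f 0 mq ≡ maybe′ g 0 mq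
        lemma (just inv) = eq _ inv
        lemma nothing    = refl

      total-+ : ∀ n f g → total n (λ q → f q + g q) ≡ total n f + total n g
      total-+ zero    f g = refl
      total-+ (suc n) f g = trans
        (total-cong n λ q _ → trans (∑-cong (suc n) λ z _ → lemma (δ q z))
                                (∑-+ (suc n) (maybe′ f 0 ∘ δ q) (maybe′ g 0 ∘ δ q)))
        (total-+ n _ _)
        where
        lemma : ∀ mq → maybe′ (λ q → f q + g q) 0 mq ≡ maybe′ f 0 mq + maybe′ g 0 mq
        lemma (just _) = refl
        lemma nothing  = refl

      total-zero : ∀ n → total n (λ _ → 0) ≡ 0
      total-zero zero    = refl
      total-zero (suc n) = trans
        (total-cong n λ q _ → trans (∑-cong (suc n) λ z _ → lemma (δ q z)) (∑-zero (suc n)))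
        (total-zero n)
        where
        lemma : ∀ mq → maybe′ {A = Q} (λ _ → 0) 0 mq ≡ 0
        lemma (just _) = refl
        lemma nothing  = refl

      total-∑ : ∀ n k (f : ℕ → Q → ℕ) → total n (λ q → ∑ k (λ s → f s q)) ≡ ∑ k (λ s → total n (f s))
      total-∑ n zero    f = total-zero n
      total-∑ n (suc k) f = trans (total-+ n _ _) (cong (total n (f 0) +_) (total-∑ n k (f ∘ suc)))

-- The two pattern classes as automaton languages

∨-mono : ∀ {a b c d} → (T a → T c) → (T b → T d) → T (a ∨ b) → T (c ∨ d)
∨-mono {true}  {c = true}  f g _ = tt
∨-mono {true}  {c = false} f g h = ⊥-elim (f h)
∨-mono {false} {c = true}  f g _ = tt
∨-mono {false} {c = false} f g h = g h

∧-mono : ∀ {a b c d} → (T a → T c) → (T b → T d) → T (a ∧ b) → T (c ∧ d)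
∧-mono {true} {c = true}  f g h = g h
∧-mono {true} {c = false} f g h = f tt

-- In its uses `a` and `a′` say that the rest of the word breaks the old and the new bound on
-- entries; `h` is a pattern begun at the new entry, and it forces `h′`, one begun at the remembered
-- entry (`M`, respectively 0).
∨-absorb : ∀ {a a′ h h′} c → (T a → T a′) → (T h → T h′) →
           a ∨ ((a′ ∨ h′) ∨ (h ∨ c)) ≡ a′ ∨ (h′ ∨ c)
∨-absorb {true}  {true}          c f g = refl
∨-absorb {true}  {false}         c f g = ⊥-elim (f tt)
∨-absorb {false} {true}          c f g = refl
∨-absorb {false} {false} {true}  {true}  c f g = refl
∨-absorb {false} {false} {true}  {false} c f g = ⊥-elim (g tt)
∨-absorb {false} {false} {false} c f g = refl

∨-absorbˡ : ∀ {a b} c → (T a → T b) → a ∨ (b ∨ c) ≡ b ∨ c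
∨-absorbˡ {true}  {true}  c f = refl
∨-absorbˡ {true}  {false} c f = ⊥-elim (f tt)
∨-absorbˡ {false}         c f = refl

anyL-mono : ∀ {p q : ℕ → Bool} → (∀ z → T (p z) → T (q z)) → ∀ xs → T (anyL p xs) → T (anyL q xs)
anyL-mono f (x ∷ xs) = ∨-mono (f x) (anyL-mono f xs)

<ᵇ-monoʳ : ∀ z {a b} → a ≤ b → T (z <ᵇ a) → T (z <ᵇ b)
<ᵇ-monoʳ z {a} a≤b h = <⇒<ᵇ (≤-trans (<ᵇ⇒< z a h) a≤b)

<ᵇ-antimonoˡ : ∀ z {a b} → a ≤ b → T (b <ᵇ z) → T (a <ᵇ z)
<ᵇ-antimonoˡ z {a} {b} a≤b h = <⇒<ᵇ (≤-trans (s≤s a≤b) (<ᵇ⇒< b z h))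

anyL-<-mono : ∀ {a b} → a ≤ b → ∀ xs → T (anyL (_<ᵇ a) xs) → T (anyL (_<ᵇ b) xs)
anyL-<-mono a≤b = anyL-mono λ z → <ᵇ-monoʳ z a≤b

hasPatFrom≥>-mono : ∀ {a b} → a ≤ b → ∀ xs → T (hasPatFrom≥> a xs) → T (hasPatFrom≥> b xs)
hasPatFrom≥>-mono a≤b (y ∷ ys) =
  ∨-mono (∧-mono (<ᵇ-monoʳ y (s≤s a≤b)) (anyL-<-mono a≤b ys)) (hasPatFrom≥>-mono a≤b ys)

-- State: the maximum of the word read, and the largest entry e_i having a later entry e_j ≤ e_i,
-- which is a lower bound for all entries to come.
State≥> : Set
State≥> = ℕ × ℕ

top thr : State≥> → ℕ
top = proj₁
thr = proj₂

-- An entry `z ≤ M` makes the maximum itself an entry with a later entry below or equal to it, so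
-- the threshold jumps to `M`; a new record forms no such pair.
δ≥> : State≥> → ℕ → Maybe State≥>
δ≥> (M , t) z = if does (t ≤? z) then just (if does (z ≤? M) then (M , M) else (z , t)) else nothing

data Step≥> (M t z : ℕ) : Maybe State≥> → Set where
  below      : z < t → Step≥> M t z nothing
  return     : t ≤ z → z ≤ M → Step≥> M t z (just (M , M))
  record-max : t ≤ z → M < z → Step≥> M t z (just (z , t))

step≥> : ∀ M t z → Step≥> M t z (δ≥> (M , t) z)
step≥> M t z with t ≤? z | z ≤? M
... | no t≰z  | _       rewrite dec-false (t ≤? z) t≰z = below (≰⇒> t≰z)
... | yes t≤z | yes z≤M rewrite dec-true (t ≤? z) t≤z | dec-true (z ≤? M) z≤M = return t≤z z≤M
... | yes t≤z | no z≰M  rewrite dec-true (t ≤? z) t≤z | dec-false (z ≤? M) z≰M = record-max t≤z (≰⇒> z≰M)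

module L = Automaton δ≥>

-- The disjuncts are the ways to complete a pattern: with its last entry, with its last two, or with
-- all three in the suffix. In the second, `M` can stand for any earlier first entry, by
-- `hasPatFrom≥>-mono`.
run≥> : ∀ {M t} → t ≤ M → ∀ xs →
        L.run (M , t) xs ≡ not (anyL (_<ᵇ t) xs ∨ (hasPatFrom≥> M xs ∨ contains≥> xs))
run≥> t≤M [] = refl
run≥> {M} {t} t≤M (z ∷ xs) with δ≥> (M , t) z | step≥> M t z
... | _ | below z<t rewrite dec-true (z <? t) z<t = refl
... | _ | return t≤z z≤M
  rewrite dec-false (z <? t) (≤⇒≯ t≤z) | dec-true (z <? suc M) (s≤s z≤M) =
  trans (run≥> ≤-refl xs)
        (cong not (sym (∨-absorb _ (anyL-<-mono t≤M xs) (hasPatFrom≥>-mono z≤M xs))))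
... | _ | record-max t≤z M<z
  rewrite dec-false (z <? t) (≤⇒≯ t≤z) | dec-false (z <? suc M) (<⇒≱ (s≤s M<z)) =
  trans (run≥> t≤z xs) (cong (λ b → not (anyL (_<ᵇ t) xs ∨ b))
        (sym (∨-absorbˡ _ (hasPatFrom≥>-mono (<⇒≤ M<z) xs))))

anyL-none : ∀ {p : ℕ → Bool} → (∀ z → ¬ T (p z)) → ∀ xs → ¬ T (anyL p xs)
anyL-none f (x ∷ xs) = ∨-mono {c = false} (f x) (anyL-none f xs)

hasPatFrom≥>-zero : ∀ xs → ¬ T (hasPatFrom≥> 0 xs)
hasPatFrom≥>-zero (y ∷ ys) = ∨-mono {c = false}
  (∧-mono {y <ᵇ 1} {c = true} (λ _ → tt) (anyL-none (λ _ ()) ys))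
  (hasPatFrom≥>-zero ys)

run≥>-start : ∀ e → not (contains≥> e) ≡ L.run (0 , 0) e
run≥>-start e = sym (trans (run≥> {0} {0} z≤n e)
  (cong not (drop (anyL-none (λ _ ()) e) (hasPatFrom≥>-zero e))))
  where
  drop : ∀ {a b c} → ¬ T a → ¬ T b → a ∨ (b ∨ c) ≡ c
  drop {true}          ¬a ¬b = ⊥-elim (¬a tt)
  drop {false} {true}  ¬a ¬b = ⊥-elim (¬b tt)
  drop {false} {false} ¬a ¬b = refl

between : ℕ → ℕ → List ℕ → Bool
between a b = anyL (λ z → (a <ᵇ z) ∧ (z <ᵇ b))

between-mono : ∀ {a b} → a ≤ b → ∀ xs → T (between 0 a xs) → T (between 0 b xs)
between-mono a≤b = anyL-mono λ z → ∧-mono {0 <ᵇ z} (λ h → h) (<ᵇ-monoʳ z a≤b)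

hasPatFrom021-antimono : ∀ {a b} → a ≤ b → ∀ xs → T (hasPatFrom021 b xs) → T (hasPatFrom021 a xs)
hasPatFrom021-antimono {a} {b} a≤b (y ∷ ys) = ∨-mono
  (anyL-mono (λ z → ∧-mono {b <ᵇ z} (<ᵇ-antimonoˡ z a≤b) (λ h → h)) ys)
  (hasPatFrom021-antimono a≤b ys)

δ021 : ℕ → ℕ → Maybe ℕ
δ021 m zero    = just m
δ021 m (suc z) = if does (m ≤? suc z) then just (suc z) else nothing

module R = Automaton δ021

-- An earlier entry 0 is presupposed: it is the best possible smallest entry of a pattern, so the
-- maximum `m` is all that remains to be remembered.
run021 : ∀ m xs → R.run m xs ≡ not (between 0 m xs ∨ (hasPatFrom021 0 xs ∨ contains021 xs))
run021 m []          = refl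
run021 m (zero ∷ xs) = trans (run021 m xs) (cong not (sym (lemma (between-mono {0} {m} z≤n xs))))
  where
  lemma : ∀ {a a′ h c} → (T a′ → T a) → a ∨ ((a′ ∨ h) ∨ (h ∨ c)) ≡ a ∨ (h ∨ c)
  lemma {true}                  f = refl
  lemma {false} {true}          f = ⊥-elim (f tt)
  lemma {false} {false} {true}  f = refl
  lemma {false} {false} {false} f = refl
run021 m (suc z ∷ xs) with m ≤? suc z
... | yes m≤z rewrite dec-true (m ≤? suc z) m≤z | dec-false (suc z <? m) (≤⇒≯ m≤z) =
  trans (run021 (suc z) xs)
        (cong not (sym (∨-absorb _ (between-mono m≤z xs) (hasPatFrom021-antimono z≤n xs))))
... | no m≰z rewrite dec-false (m ≤? suc z) m≰z | dec-true (suc z <? m) (≰⇒> m≰z) = refl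

run021-start : ∀ xs → not (contains021 (0 ∷ xs)) ≡ R.run 0 (0 ∷ xs)
run021-start xs = sym (trans (run021 0 xs) (cong not
  (∨-absorbˡ {b = hasPatFrom021 0 xs} _ λ h → ⊥-elim (anyL-none none xs h))))
  where
  none : ∀ z → ¬ T ((0 <ᵇ z) ∧ (z <ᵇ 0))
  none zero    ()
  none (suc z) ()

-- The threshold distribution of the (≥,-,>)-avoiders

open L.Total (0 , 0) using () renaming (total to E)

-- The threshold is one step behind the maximum because the entry attaining it is followed by
-- another; `pred` truncates at the short lengths.
Inv≥> : ℕ → State≥> → Set
Inv≥> n (M , t) = t ≤ M × M ≤ pred n × t ≤ pred (pred n)

inv≥>-step : ∀ {n q z} → Inv≥> n q → z ≤ n → All (Inv≥> (suc n)) (δ≥> q z)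
inv≥>-step {n} {M , t} {z} (t≤M , M≤n , t≤n) z≤n′ with δ≥> (M , t) z | step≥> M t z
... | _ | below z<t = nothing
... | _ | return t≤z z≤M = just (≤-refl , ≤-trans M≤n pred[n]≤n , M≤n)
... | _ | record-max t≤z M<z = just (t≤z , z≤n′ , ≤-trans t≤n pred[n]≤n)

open L.Total.Invariant (0 , 0) Inv≥> (z≤n , z≤n , z≤n) inv≥>-step
  using () renaming (total-cong to E-cong; total-+ to E-+; total-zero to E-zero; total-∑ to E-∑)

E-top<suc : ∀ n M (φ : ℕ → ℕ) →
  E n (λ q → ⟦ top q <? suc M ⟧ * φ (thr q)) ≡
  E n (λ q → ⟦ top q <? M ⟧ * φ (thr q)) + E n (λ q → ⟦ top q ≟ M ⟧ * φ (thr q))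
E-top<suc n M φ = trans
  (E-cong n λ q _ → trans (cong (_* φ (thr q)) (⟦<suc⟧ (top q) M))
                          (*-distribʳ-+ (φ (thr q)) ⟦ top q <? M ⟧ ⟦ top q ≟ M ⟧))
  (E-+ n _ _)

-- Since φ M = 0, the maximum M has just been appended as a new record.
E-top≡ : ∀ {n M} (φ : ℕ → ℕ) → φ M ≡ 0 → M ≤ n →
  E (suc n) (λ q → ⟦ top q ≟ M ⟧ * φ (thr q)) ≡ E n (λ q → ⟦ top q <? M ⟧ * φ (thr q))
E-top≡ {n} {M} φ φM≡0 M≤n = E-cong n λ { (M′ , t) (t≤M′ , _) →
  trans (∑-cong (suc n) λ z _ → letter t≤M′ z) (∑-pick (λ z → ⟦ M′ <? z ⟧ * φ t) (s≤s M≤n)) }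
  where
  f : State≥> → ℕ
  f q = ⟦ top q ≟ M ⟧ * φ (thr q)
  f-diagonal : ∀ M′ → f (M′ , M′) ≡ 0
  f-diagonal M′ with M′ ≟ M
  ... | yes refl = trans (cong (⟦ M ≟ M ⟧ *_) φM≡0) (*-zeroʳ ⟦ M ≟ M ⟧)
  ... | no M′≢M  = cong (_* φ M′) (⟦⟧-no (M′ ≟ M) M′≢M)
  letter : ∀ {M′ t} → t ≤ M′ → ∀ z →
           maybe′ f 0 (δ≥> (M′ , t) z) ≡ ⟦ z ≟ M ⟧ * (⟦ M′ <? z ⟧ * φ t)
  letter {M′} {t} t≤M′ z with δ≥> (M′ , t) z | step≥> M′ t z
  ... | _ | below z<t
    rewrite dec-false (M′ <? z) (≤⇒≯ (≤-trans (<⇒≤ z<t) t≤M′)) =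
    sym (*-zeroʳ ⟦ z ≟ M ⟧)
  ... | _ | return t≤z z≤M′
    rewrite dec-false (M′ <? z) (≤⇒≯ z≤M′) =
    trans (f-diagonal M′) (sym (*-zeroʳ ⟦ z ≟ M ⟧))
  ... | _ | record-max t≤z M′<z
    rewrite dec-true (M′ <? z) M′<z =
    cong (⟦ z ≟ M ⟧ *_) (sym (+-identityʳ (φ t)))

-- The last letter ranges over [t′, t], where t′ was the previous threshold.
E-diagonal : ∀ {n t} → t ≤ n →
  E (suc n) (λ q → ⟦ top q ≟ t ⟧ * ⟦ thr q ≟ t ⟧) ≡
  ∑ (suc t) (λ s → E n (λ q → ⟦ top q ≟ t ⟧ * ⟦ thr q ≤? s ⟧))
E-diagonal {n} {t} t≤n = trans
  (E-cong n λ { (M′ , t′) (t′≤M′ , _) →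
    trans (∑-cong (suc n) λ z _ → letter t′≤M′ z)
          (∑-truncate (λ z → ⟦ M′ ≟ t ⟧ * ⟦ t′ ≤? z ⟧) (s≤s t≤n)) })
  (E-∑ n (suc t) λ s q → ⟦ top q ≟ t ⟧ * ⟦ thr q ≤? s ⟧)
  where
  f : State≥> → ℕ
  f q = ⟦ top q ≟ t ⟧ * ⟦ thr q ≟ t ⟧
  letter : ∀ {M′ t′} → t′ ≤ M′ → ∀ z →
           maybe′ f 0 (δ≥> (M′ , t′) z) ≡ ⟦ M′ ≟ t ⟧ * ⟦ t′ ≤? z ⟧ * ⟦ z <? suc t ⟧
  letter {M′} {t′} t′≤M′ z with δ≥> (M′ , t′) z | step≥> M′ t′ z
  ... | _ | below z<t′
    rewrite dec-false (t′ ≤? z) (<⇒≱ z<t′) | *-zeroʳ ⟦ M′ ≟ t ⟧ = refl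
  ... | _ | return t′≤z z≤M′
    rewrite dec-true (t′ ≤? z) t′≤z = diagonal (M′ ≟ t)
    where
    diagonal : Dec (M′ ≡ t) → f (M′ , M′) ≡ ⟦ M′ ≟ t ⟧ * 1 * ⟦ z <? suc t ⟧
    diagonal (yes refl) rewrite dec-true (M′ ≟ M′) refl | dec-true (z <? suc M′) (s≤s z≤M′) = refl
    diagonal (no M′≢t)  rewrite dec-false (M′ ≟ t) M′≢t = refl
  -- After a record the threshold is strictly below the maximum, so the two cannot both be `t`; on
  -- the other side `z` exceeds `M′`, hence is cut off when `M′ = t`.
  ... | _ | record-max t′≤z M′<z = trans (left (z ≟ t)) (sym (right (M′ ≟ t)))
    where
    left : Dec (z ≡ t) → f (z , t′) ≡ 0
    left (yes refl) rewrite dec-false (t′ ≟ z) (<⇒≢ (≤-<-trans t′≤M′ M′<z)) = *-zeroʳ ⟦ z ≟ z ⟧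
    left (no z≢t)   rewrite dec-false (z ≟ t) z≢t = refl
    right : Dec (M′ ≡ t) → ⟦ M′ ≟ t ⟧ * ⟦ t′ ≤? z ⟧ * ⟦ z <? suc t ⟧ ≡ 0
    right (yes refl) rewrite dec-false (z <? suc M′) (<⇒≱ (s≤s M′<z)) = *-zeroʳ (⟦ M′ ≟ M′ ⟧ * ⟦ t′ ≤? z ⟧)
    right (no M′≢t)  rewrite dec-false (M′ ≟ t) M′≢t = refl

-- Split off the words attaining the largest allowed maximum. If it exceeds `t`, that maximum is a
-- record just appended, and removing it leaves instances of the induction hypothesis. If it equals
-- `t`, `E-diagonal` gives a sum over `s ≤ t`: the term `s = t` is kept, and the terms `s < t` are
-- reassembled by induction.
E-thr≡ : ∀ n M t → t < M → M ≤ n →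
  E (suc n) (λ q → ⟦ top q <? M ⟧ * ⟦ thr q ≟ t ⟧) ≡ E n (λ q → ⟦ top q <? M ⟧ * ⟦ thr q ≤? t ⟧)
E-thr≡ (suc n) (suc M) t (s≤s t≤M) (s≤s M≤n) with m≤n⇒m<n∨m≡n t≤M
... | inj₁ t<M = begin
  E (2 + n) (λ q → ⟦ top q <? suc M ⟧ * ⟦ thr q ≟ t ⟧)
    ≡⟨ E-top<suc (2 + n) M (λ s → ⟦ s ≟ t ⟧) ⟩
  E (2 + n) (λ q → ⟦ top q <? M ⟧ * ⟦ thr q ≟ t ⟧) + E (2 + n) (λ q → ⟦ top q ≟ M ⟧ * ⟦ thr q ≟ t ⟧)
    ≡⟨ cong₂ _+_ (E-thr≡ (suc n) M t t<M (m≤n⇒m≤1+n M≤n))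
                 (E-top≡ (λ s → ⟦ s ≟ t ⟧) (⟦⟧-no (M ≟ t) (<⇒≢ t<M ∘ sym)) (m≤n⇒m≤1+n M≤n)) ⟩
  E (1 + n) (λ q → ⟦ top q <? M ⟧ * ⟦ thr q ≤? t ⟧) + E (1 + n) (λ q → ⟦ top q <? M ⟧ * ⟦ thr q ≟ t ⟧)
    -- Since `t < M`, the indicators of "exactly `t`" and of "at most `t`" both vanish at `M`, so a
    -- record `M` can be removed before the induction hypothesis and put back after it.
    ≡⟨ cong (E (1 + n) (λ q → ⟦ top q <? M ⟧ * ⟦ thr q ≤? t ⟧) +_)
         (trans (E-thr≡ n M t t<M M≤n)
                (sym (E-top≡ (λ s → ⟦ s ≤? t ⟧) (⟦⟧-no (M ≤? t) (<⇒≱ t<M)) M≤n))) ⟩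
  E (1 + n) (λ q → ⟦ top q <? M ⟧ * ⟦ thr q ≤? t ⟧) + E (1 + n) (λ q → ⟦ top q ≟ M ⟧ * ⟦ thr q ≤? t ⟧)
    ≡⟨ E-top<suc (1 + n) M (λ s → ⟦ s ≤? t ⟧) ⟨
  E (1 + n) (λ q → ⟦ top q <? suc M ⟧ * ⟦ thr q ≤? t ⟧) ∎
... | inj₂ refl = begin
  E (2 + n) (λ q → ⟦ top q <? suc t ⟧ * ⟦ thr q ≟ t ⟧)
    ≡⟨ E-top<suc (2 + n) t (λ s → ⟦ s ≟ t ⟧) ⟩
  E (2 + n) (λ q → ⟦ top q <? t ⟧ * ⟦ thr q ≟ t ⟧) + E (2 + n) (λ q → ⟦ top q ≟ t ⟧ * ⟦ thr q ≟ t ⟧)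
    -- The first summand is 0: the threshold never exceeds the maximum.
    ≡⟨ cong₂ _+_ (trans (E-cong (2 + n) λ q inv → vanish q (proj₁ inv)) (E-zero (2 + n)))
                 (E-diagonal (m≤n⇒m≤1+n M≤n)) ⟩
  ∑ (suc t) (λ s → E (1 + n) (λ q → ⟦ top q ≟ t ⟧ * ⟦ thr q ≤? s ⟧))
    ≡⟨ ∑-last t _ ⟩
  ∑ t (λ s → E (1 + n) (λ q → ⟦ top q ≟ t ⟧ * ⟦ thr q ≤? s ⟧)) + E (1 + n) (λ q → ⟦ top q ≟ t ⟧ * ⟦ thr q ≤? t ⟧)
    -- For `s < t`, removing the record `t` and using the induction hypothesis backwards turns "at
    -- most `s`" into "exactly `s`", which can be summed over `s`.
    ≡⟨ cong (_+ E (1 + n) (λ q → ⟦ top q ≟ t ⟧ * ⟦ thr q ≤? t ⟧)) (begin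
      ∑ t (λ s → E (1 + n) (λ q → ⟦ top q ≟ t ⟧ * ⟦ thr q ≤? s ⟧))
        ≡⟨ ∑-cong t (λ s s<t → trans
             (E-top≡ (λ r → ⟦ r ≤? s ⟧) (⟦⟧-no (t ≤? s) (<⇒≱ s<t)) M≤n)
             (sym (E-thr≡ n t s s<t M≤n))) ⟩
      ∑ t (λ s → E (1 + n) (λ q → ⟦ top q <? t ⟧ * ⟦ thr q ≟ s ⟧))
        ≡⟨ E-∑ (1 + n) t _ ⟨
      E (1 + n) (λ q → ∑ t (λ s → ⟦ top q <? t ⟧ * ⟦ thr q ≟ s ⟧))
        -- A threshold under a maximum below `t` is itself below `t`, so `<` and `≤` agree here.
        ≡⟨ E-cong (1 + n) (λ q inv → collect q (proj₁ inv)) ⟩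
      E (1 + n) (λ q → ⟦ top q <? t ⟧ * ⟦ thr q ≤? t ⟧) ∎) ⟩
  E (1 + n) (λ q → ⟦ top q <? t ⟧ * ⟦ thr q ≤? t ⟧) + E (1 + n) (λ q → ⟦ top q ≟ t ⟧ * ⟦ thr q ≤? t ⟧)
    ≡⟨ E-top<suc (1 + n) t (λ s → ⟦ s ≤? t ⟧) ⟨
  E (1 + n) (λ q → ⟦ top q <? suc t ⟧ * ⟦ thr q ≤? t ⟧) ∎
  where
  vanish : ∀ q → thr q ≤ top q → ⟦ top q <? t ⟧ * ⟦ thr q ≟ t ⟧ ≡ 0
  vanish (M′ , t′) t′≤M′ with M′ <? t
  ... | yes M′<t rewrite dec-false (t′ ≟ t) (<⇒≢ (≤-<-trans t′≤M′ M′<t)) = *-zeroʳ ⟦ M′ <? t ⟧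
  ... | no M′≮t  rewrite dec-false (M′ <? t) M′≮t = refl
  collect : ∀ q → thr q ≤ top q →
            ∑ t (λ s → ⟦ top q <? t ⟧ * ⟦ thr q ≟ s ⟧) ≡ ⟦ top q <? t ⟧ * ⟦ thr q ≤? t ⟧
  collect (M′ , t′) t′≤M′ = trans (∑-*ˡ ⟦ M′ <? t ⟧ t _)
    (trans (cong (⟦ M′ <? t ⟧ *_) (∑-⟦≟⟧ t t′)) (lemma (M′ <? t)))
    where
    lemma : Dec (M′ < t) → ⟦ M′ <? t ⟧ * ⟦ t′ <? t ⟧ ≡ ⟦ M′ <? t ⟧ * ⟦ t′ ≤? t ⟧
    lemma (yes M′<t) = cong (⟦ M′ <? t ⟧ *_)
      (⟦⟧-cong (t′ <? t) (t′ ≤? t) <⇒≤ (λ _ → ≤-<-trans t′≤M′ M′<t))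
    lemma (no M′≮t) rewrite dec-false (M′ <? t) M′≮t = refl

-- Recurrence for the threshold counts

thr-count : ℕ → ℕ → ℕ
thr-count n k = E n (λ q → ⟦ thr q ≤? k ⟧)

E-bounded-top : ∀ {n M} (φ : ℕ → ℕ) → pred n < M →
  E n (λ q → φ (thr q)) ≡ E n (λ q → ⟦ top q <? M ⟧ * φ (thr q))
E-bounded-top {n} {M} φ n<M = E-cong n λ { (M′ , t′) (_ , M′≤n , _) → sym (trans
  (cong (_* φ t′) (⟦⟧-yes (M′ <? M) (≤-<-trans M′≤n n<M))) (+-identityʳ (φ t′))) }

pred-< : ∀ {t n} → t < n → pred n < n
pred-< {n = suc n} _ = ≤-refl

-- Words of maximum below `n` are handled by `E-thr≡` with bound `n`. In the others the last entry
-- is the record `n`, which may follow any word and keeps its threshold.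
E-thr≡-suc : ∀ {n t} → t < n → E (suc n) (λ q → ⟦ thr q ≟ t ⟧) ≡ thr-count n t + E n (λ q → ⟦ thr q ≟ t ⟧)
E-thr≡-suc {n} {t} t<n = begin
  E (suc n) (λ q → ⟦ thr q ≟ t ⟧)
    ≡⟨ E-bounded-top {suc n} (λ s → ⟦ s ≟ t ⟧) ≤-refl ⟩
  E (suc n) (λ q → ⟦ top q <? suc n ⟧ * ⟦ thr q ≟ t ⟧)
    ≡⟨ E-top<suc (suc n) n (λ s → ⟦ s ≟ t ⟧) ⟩
  E (suc n) (λ q → ⟦ top q <? n ⟧ * ⟦ thr q ≟ t ⟧) + E (suc n) (λ q → ⟦ top q ≟ n ⟧ * ⟦ thr q ≟ t ⟧)
    ≡⟨ cong₂ _+_ (E-thr≡ n n t t<n ≤-refl)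
                 (E-top≡ {n} (λ s → ⟦ s ≟ t ⟧) (⟦⟧-no (n ≟ t) (<⇒≢ t<n ∘ sym)) ≤-refl) ⟩
  E n (λ q → ⟦ top q <? n ⟧ * ⟦ thr q ≤? t ⟧) + E n (λ q → ⟦ top q <? n ⟧ * ⟦ thr q ≟ t ⟧)
    ≡⟨ cong₂ _+_ (E-bounded-top {n} (λ s → ⟦ s ≤? t ⟧) (pred-< t<n))
                 (E-bounded-top {n} (λ s → ⟦ s ≟ t ⟧) (pred-< t<n)) ⟨
  thr-count n t + E n (λ q → ⟦ thr q ≟ t ⟧) ∎

thr-count-∑ : ∀ n k → thr-count n k ≡ ∑ (suc k) (λ t → E n (λ q → ⟦ thr q ≟ t ⟧))
thr-count-∑ n k = trans
  (E-cong n λ q _ → trans (⟦⟧-cong (thr q ≤? k) (thr q <? suc k) s≤s s≤s⁻¹) (sym (∑-⟦≟⟧ (suc k) (thr q))))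
  (E-∑ n (suc k) λ t q → ⟦ thr q ≟ t ⟧)

thr-count-suc : ∀ {n k} → k < n → thr-count (suc n) k ≡ thr-count n k + ∑ (suc k) (thr-count n)
thr-count-suc {n} {k} k<n = begin
  thr-count (suc n) k
    ≡⟨ thr-count-∑ (suc n) k ⟩
  ∑ (suc k) (λ t → E (suc n) (λ q → ⟦ thr q ≟ t ⟧))
    ≡⟨ ∑-cong (suc k) (λ t t≤k → E-thr≡-suc (≤-<-trans (s≤s⁻¹ t≤k) k<n)) ⟩
  ∑ (suc k) (λ t → thr-count n t + E n (λ q → ⟦ thr q ≟ t ⟧))
    ≡⟨ ∑-+ (suc k) (thr-count n) (λ t → E n (λ q → ⟦ thr q ≟ t ⟧)) ⟩
  ∑ (suc k) (thr-count n) + ∑ (suc k) (λ t → E n (λ q → ⟦ thr q ≟ t ⟧))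
    ≡⟨ cong (∑ (suc k) (thr-count n) +_) (thr-count-∑ n k) ⟨
  ∑ (suc k) (thr-count n) + thr-count n k
    ≡⟨ +-comm _ (thr-count n k) ⟩
  thr-count n k + ∑ (suc k) (thr-count n) ∎

-- The distribution of the maximum of the 021-avoiders

open R.Total 0 using () renaming (total to E′)

Inv021 : ℕ → ℕ → Set
Inv021 n m = m ≤ pred n

inv021-step : ∀ {n m z} → Inv021 n m → z ≤ n → All (Inv021 (suc n)) (δ021 m z)
inv021-step {z = zero}  m≤n _ = just (≤-trans m≤n pred[n]≤n)
inv021-step {m = m} {suc z} _ z<n with does (m ≤? suc z)
... | true  = just z<n
... | false = nothing

open R.Total.Invariant 0 Inv021 z≤n (λ {n} {q} {z} → inv021-step {n} {q} {z})
  using () renaming (total-cong to E′-cong; total-+ to E′-+; total-∑ to E′-∑)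

-- The shift to `suc k` matches the last entry `k + 1` on the right-hand side, which may follow a
-- maximum `m` exactly when `m ≤ k + 1`.
max-count : ℕ → ℕ → ℕ
max-count n k = E′ n (λ m → ⟦ m ≤? suc k ⟧)

maybe-δ021 : ∀ (f : ℕ → ℕ) m z → maybe′ f 0 (δ021 m (suc z)) ≡ ⟦ m ≤? suc z ⟧ * f (suc z)
maybe-δ021 f m z with does (m ≤? suc z)
... | true  = sym (+-identityʳ _)
... | false = refl

-- The letter 0 keeps the maximum and gives the first summand; a letter `suc z`, allowed when
-- `m ≤ suc z`, becomes the maximum and counts when `z ≤ k`.
max-count-suc : ∀ {n k} → k < n → max-count (suc n) k ≡ max-count n k + ∑ (suc k) (max-count n)
max-count-suc {n} {k} k<n = begin
  max-count (suc n) k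
    ≡⟨ E′-cong n (λ m _ → cong (⟦ m ≤? suc k ⟧ +_) (trans
         (∑-cong n λ z _ → maybe-δ021 (λ m′ → ⟦ m′ ≤? suc k ⟧) m z)
         (∑-truncate (λ z → ⟦ m ≤? suc z ⟧) k<n))) ⟩
  E′ n (λ m → ⟦ m ≤? suc k ⟧ + ∑ (suc k) (λ z → ⟦ m ≤? suc z ⟧))
    ≡⟨ E′-+ n (λ m → ⟦ m ≤? suc k ⟧) _ ⟩
  max-count n k + E′ n (λ m → ∑ (suc k) (λ z → ⟦ m ≤? suc z ⟧))
    ≡⟨ cong (max-count n k +_) (E′-∑ n (suc k) λ z m → ⟦ m ≤? suc z ⟧) ⟩
  max-count n k + ∑ (suc k) (max-count n) ∎

-- Equality of the two distributions

⟦≤⟧-stable : ∀ {x j k} → x ≤ j → j ≤ k → ⟦ x ≤? k ⟧ ≡ ⟦ x ≤? j ⟧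
⟦≤⟧-stable {x} {j} {k} x≤j j≤k = trans (⟦⟧-yes (x ≤? k) (≤-trans x≤j j≤k)) (sym (⟦⟧-yes (x ≤? j) x≤j))

thr≡max-count-below : ∀ n → (∀ t → thr-count n t ≡ max-count n t) →
  ∀ {k} → k < n → thr-count (suc n) k ≡ max-count (suc n) k
thr≡max-count-below n ih {k} k<n = begin
  thr-count (suc n) k                      ≡⟨ thr-count-suc k<n ⟩
  thr-count n k + ∑ (suc k) (thr-count n)  ≡⟨ cong₂ _+_ (ih k) (∑-cong (suc k) λ t _ → ih t) ⟩
  max-count n k + ∑ (suc k) (max-count n)  ≡⟨ max-count-suc k<n ⟨
  max-count (suc n) k                      ∎

thr≡max-count-suc : ∀ n → (∀ t → thr-count (suc n) t ≡ max-count (suc n) t) →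
  ∀ k → thr-count (2 + n) k ≡ max-count (2 + n) k
thr≡max-count-suc n ih k with k <? suc n
... | yes k≤n = thr≡max-count-below (suc n) ih k≤n
... | no k≰n  = begin
  -- At length `2 + n` thresholds are at most `n` and maxima at most `1 + n`, so both counts are
  -- constant from `k = n` on, and the recurrence still covers `k = n`.
  thr-count (2 + n) k  ≡⟨ E-cong (2 + n) (λ { _ (_ , _ , t≤n) → ⟦≤⟧-stable t≤n n≤k }) ⟩
  thr-count (2 + n) n  ≡⟨ thr≡max-count-below (suc n) ih {n} ≤-refl ⟩
  max-count (2 + n) n  ≡⟨ E′-cong (2 + n) (λ m m≤1+n → ⟦≤⟧-stable m≤1+n (s≤s n≤k)) ⟨
  max-count (2 + n) k  ∎
  where
  n≤k : n ≤ k
  n≤k = <⇒≤ (≮⇒≥ k≰n)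

thr≡max-count : ∀ n k → thr-count n k ≡ max-count n k
thr≡max-count zero          k = refl
thr≡max-count (suc zero)    k = refl
thr≡max-count (suc (suc n)) k = thr≡max-count-suc n (thr≡max-count (suc n)) k

-- Reading the last entry on both sides

count-left : ∀ n k → k ≤ n →
  ∑words (suc n) 1 (λ e → ind (not (contains≥> e) ∧ (lastE e ≡ᵇ k))) ≡ thr-count n k
count-left n k k≤n = begin
  ∑words (suc n) 1 (λ e → ind (not (contains≥> e) ∧ (lastE e ≡ᵇ k)))
    ≡⟨ ∑words-cong (suc n) 1 (λ e → cong (λ r → ind (r ∧ (lastE e ≡ᵇ k))) (run≥>-start e)) ⟩
  ∑words (suc n) 1 (λ e → ind (L.run (0 , 0) e ∧ (lastE e ≡ᵇ k)))
    ≡⟨ L.Total.count-last (0 , 0) (_≡ᵇ k) n ⟩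
  E n (L.enabled (_≡ᵇ k) (suc n))
    ≡⟨ E-cong n (λ q _ → trans (∑-pick (λ z → maybe′ (λ _ → 1) 0 (δ≥> q z)) (s≤s k≤n)) (enabled q)) ⟩
  thr-count n k ∎
  where
  enabled : ∀ q → maybe′ (λ _ → 1) 0 (δ≥> q k) ≡ ⟦ thr q ≤? k ⟧
  enabled (M , t) with does (t ≤? k)
  ... | true  = refl
  ... | false = refl

count-right : ∀ n k → k ≤ n →
  ∑words (suc n) 1 (λ e → ind (not (contains021 e) ∧ ((lastE e % suc n) ≡ᵇ (suc k % suc n)))) ≡ max-count n k
count-right n k k≤n = begin
  ∑words (suc n) 1 (λ e → ind (not (contains021 e) ∧ φ (lastE e)))
    -- The first letter is below 1, hence 0, as `run021-start` demands; the `0` added is the empty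
    -- rest of the sum over it.
    ≡⟨ cong (_+ 0) (∑words-cong n 2 λ xs → cong (λ r → ind (r ∧ φ (lastE (0 ∷ xs)))) (run021-start xs)) ⟩
  ∑words (suc n) 1 (λ e → ind (R.run 0 e ∧ φ (lastE e)))
    ≡⟨ R.Total.count-last 0 φ n ⟩
  E′ n (R.enabled φ (suc n))
    ≡⟨ E′-cong n enabled ⟩
  max-count n k ∎
  where
  φ : ℕ → Bool
  φ z = (z % suc n) ≡ᵇ (suc k % suc n)
  enabled-at : ∀ m {j} → suc k % suc n ≡ j → j ≤ n →
               R.enabled φ (suc n) m ≡ maybe′ (λ _ → 1) 0 (δ021 m j)
  enabled-at m {j} eq j≤n = trans
    (∑-cong (suc n) λ z z≤n′ → cong (λ c → ind c * maybe′ (λ _ → 1) 0 (δ021 m z))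
      (cong₂ _≡ᵇ_ (m<n⇒m%n≡m z≤n′) eq))
    (∑-pick (λ z → maybe′ (λ _ → 1) 0 (δ021 m z)) (s≤s j≤n))
  enabled : ∀ m → m ≤ pred n → R.enabled φ (suc n) m ≡ ⟦ m ≤? suc k ⟧
  enabled m m≤n with m≤n⇒m<n∨m≡n k≤n
  -- Here `k + 1` is its own residue, and it is a positive letter.
  ... | inj₁ k<n  = trans (enabled-at m (m<n⇒m%n≡m (s≤s k<n)) k<n)
                          (trans (maybe-δ021 (λ _ → 1) m k) (*-identityʳ _))
  -- For `k = n` the residue is 0. The letter 0 is always allowed, and `m ≤ suc k` always holds, so
  -- both sides are 1.
  ... | inj₂ refl = trans (enabled-at m (n%n≡0 (suc n)) z≤n)
                          (sym (⟦⟧-yes (m ≤? suc k) (m≤n⇒m≤1+n (≤-trans m≤n pred[n]≤n))))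

theorem3p1 : (n k : ℕ) → 1 ≤ n → k < n → LeftSet n k ⤖ RightSet n k
theorem3p1 (suc n) k _ (s≤s k≤n) = ↔⇒⤖ (↔-sym (Words↔Fin (suc n) 1 _) ↔-∘
  subst (λ c → LeftSet (suc n) k ↔ Fin c)
    (trans (count-left n k k≤n) (trans (thr≡max-count n k) (sym (count-right n k k≤n))))
    (Words↔Fin (suc n) 1 _))
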